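{- Let $f_0,f_1,\dots,f_k$ be finitely many injective computable functions, each defined on every element of $C$, where $C\subseteq\omega$ is an infinite computable set. Then there is an infinite computable set $H\subseteq C$ such that $\overline{\rho}(f_i(H))=0$ for all $i\le k$.
   Context: $\rho_n(S)=|S\cap\{0,\dots,n-1\}|/n$ and $\overline{\rho}(S)=\limsup_n\rho_n(S)$. -}

module Defs where

open import Data.Nat using (ℕ; _≤_; _<_; _*_; NonZero)
open import Data.Bool using (Bool; true)
open import Data.Product using (Σ; ∃; _×_)
open import Data.List using (List; length)
open import Data.List.Relation.Unary.All using (All)
open import Data.List.Relation.Unary.Unique.Propositional using (Unique)
open import Relation.Binary.PropositionalEquality using (_≡_)

-- A computable subset of ω is represented by its (total, Agda-computable)
-- characteristic function.
DecSet : Set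
DecSet = ℕ → Bool

_∈ₛ_ : ℕ → DecSet → Set
x ∈ₛ A = A x ≡ true

_⊆ₛ_ : DecSet → DecSet → Set
A ⊆ₛ B = ∀ x → x ∈ₛ A → x ∈ₛ B

Infinite : DecSet → Set
Infinite A = ∀ n → ∃ λ m → n ≤ m × m ∈ₛ A

InjectiveOn : (ℕ → ℕ) → DecSet → Set
InjectiveOn f C = ∀ x y → x ∈ₛ C → y ∈ₛ C → f x ≡ f y → x ≡ y

InImage : (ℕ → ℕ) → DecSet → ℕ → Set
InImage f H y = ∃ λ h → h ∈ₛ H × f h ≡ y

-- "|S ∩ {0,…,n-1}| ≤ n / m", for S given as a (not necessarily decidable)
-- predicate: every duplicate-free list of elements of S below n has
-- length ℓ with m * ℓ ≤ n.
CountBound : (ℕ → Set) → ℕ → ℕ → Set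
CountBound S m n =
  (xs : List ℕ) → Unique xs → All (λ y → y < n × S y) xs → m * length xs ≤ n

-- Upper density zero: for every m ≥ 1, eventually ρ_n(S) ≤ 1/m.
-- (Equivalent to limsup_n ρ_n(S) = 0 since ρ_n ≥ 0.)
UpperDensityZero : (ℕ → Set) → Set
UpperDensityZero S = ∀ m → .{{NonZero m}} → ∃ λ N → ∀ n → N ≤ n → CountBound S m n

module Submission where

-- Call x ∈ C "T-large" if f i x ≥ T for every i ≤ k.
--   * Pigeonhole: each f i is injective on C, so it maps at most T points of C
--     below T; hence among any (k+1)·T + 1 distinct points of C one is T-large.
--     As C is infinite, there are T-large points of C above every bound L.
--   * Choose h j ∈ C with h j ≥ j and h j (j+1)²-large, and let H be the
--     range of h.  It is decidable because h j ≥ j, infinite because h j ≥ j,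
--     and contained in C.
--   * Each image f i (H) is contained in the range of a s = f i (h s), which
--     grows quadratically: (s+1)² ≤ a s.  The range of any such sequence has
--     upper density zero: if m² ≤ n, each of its elements below n equals a s
--     for some s with m·(s+1) ≤ n, so there are at most n / m of them.

open import Defs
open import Data.Nat using (ℕ; suc; zero; _*_; _≤_; _<_; _≤?_; _≟_; NonZero; s≤s)
open import Data.Nat.Properties
open import Data.Nat.DivMod using (_/_; m*n/n≡m; m/n*n≤m; /-monoˡ-≤)
open import Data.Fin using (Fin; toℕ; fromℕ<; combine)
open import Data.Fin.Properties
  using (any?; all?; ¬∀⟶∃¬; pigeonhole; combine-injective; toℕ-fromℕ<; fromℕ<-injective)
open import Data.Product using (∃; _×_; _,_; proj₁; proj₂; map₂)
open import Data.Sum using (inj₁; inj₂)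
open import Data.Bool using (true)
open import Data.Empty using (⊥; ⊥-elim)
open import Data.List using (List; _∷_; length; lookup)
open import Data.List.Relation.Unary.All as All using (All)
open import Data.List.Relation.Unary.AllPairs using (_∷_)
open import Data.List.Relation.Unary.Unique.Propositional using (Unique)
open import Data.List.Membership.Propositional.Properties using (∈-lookup)
open import Relation.Nullary using (Dec; yes; no; does)
open import Relation.Nullary.Decidable using (dec-true)
open import Relation.Binary.PropositionalEquality using (_≡_; refl; sym; trans; cong; subst)

unique-lookup : {A : Set} (xs : List A) → Unique xs → (i j : Fin (length xs)) →
  toℕ i < toℕ j → lookup xs i ≡ lookup xs j → ⊥
unique-lookup (x ∷ xs) (x∉xs ∷ _) Fin.zero (Fin.suc j) _ same =
  All.lookup x∉xs (∈-lookup j) same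
unique-lookup (x ∷ xs) (_ ∷ u) (Fin.suc i) (Fin.suc j) (s≤s i<j) same =
  unique-lookup xs u i j i<j same

length-≤-by-codes : {A : Set} {B : ℕ} (Code : A → ℕ → Set) (xs : List A) → Unique xs →
  (∀ {x y s} → Code x s → Code y s → x ≡ y) →
  All (λ x → ∃ λ s → s < B × Code x s) xs → length xs ≤ B
length-≤-by-codes {B = B} Code xs u unshared codes with length xs ≤? B
... | yes fits = fits
... | no overflow = ⊥-elim collision
  where
  index : Fin (length xs) → ℕ
  index t = proj₁ (All.lookup codes (∈-lookup t))
  code-of : ∀ t → Code (lookup xs t) (index t)
  code-of t = proj₂ (proj₂ (All.lookup codes (∈-lookup t)))
  code : Fin (length xs) → Fin B
  code t = fromℕ< (proj₁ (proj₂ (All.lookup codes (∈-lookup t))))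
  collision : ⊥
  collision with pigeonhole (≰⇒> overflow) code
  ... | a , b , a<b , same-code =
    unique-lookup xs u a b a<b (unshared (code-of a) (subst (Code _) (sym same-index) (code-of b)))
    where
    same-index : index a ≡ index b
    same-index = fromℕ<-injective _ _ _ _ same-code

density-zero-⊆ : {S S′ : ℕ → Set} → (∀ y → S′ y → S y) →
  UpperDensityZero S → UpperDensityZero S′
density-zero-⊆ S′⊆S zero-S m with zero-S m
... | N , bound = N , λ n N≤n xs u members →
  bound n N≤n xs u (All.map (λ (y<n , y∈S′) → y<n , S′⊆S _ y∈S′) members)

Range : (ℕ → ℕ) → ℕ → Set
Range a y = ∃ λ s → a s ≡ y

≤-quotient : ∀ {q n} m .{{_ : NonZero m}} → m * q ≤ n → q ≤ n / m
≤-quotient {q} {n} m mq≤n =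
  subst (_≤ n / m) (m*n/n≡m q m) (/-monoˡ-≤ m (subst (_≤ n) (*-comm m q) mq≤n))

times-quotient-≤ : ∀ n m .{{_ : NonZero m}} → m * (n / m) ≤ n
times-quotient-≤ n m = subst (_≤ n) (*-comm (n / m) m) (m/n*n≤m n m)

index-bound : ∀ m n s → m * m ≤ n → suc s * suc s ≤ n → m * suc s ≤ n
index-bound m n s m²≤n sq≤n with suc s ≤? m
... | yes s<m = ≤-trans (*-monoʳ-≤ m s<m) m²≤n
... | no s≮m = ≤-trans (*-monoˡ-≤ (suc s) (<⇒≤ (≰⇒> s≮m))) sq≤n

-- A sequence growing at least quadratically has a range of upper density 0:
-- once m² ≤ n, its elements below n are a s with s < n / m, and s is a code.
quadratic-range-density : (a : ℕ → ℕ) → (∀ s → suc s * suc s ≤ a s) →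
  UpperDensityZero (Range a)
quadratic-range-density a grows m = m * m , bound
  where
  bound : ∀ n → m * m ≤ n → CountBound (Range a) m n
  bound n m²≤n xs u members =
    ≤-trans (*-monoʳ-≤ m (length-≤-by-codes (λ y s → a s ≡ y) xs u unshared codes))
            (times-quotient-≤ n m)
    where
    unshared : ∀ {x y s} → a s ≡ x → a s ≡ y → x ≡ y
    unshared as≡x as≡y = trans (sym as≡x) as≡y
    code : ∀ {y} → y < n × Range a y → ∃ λ s → s < n / m × a s ≡ y
    code (y<n , s , as≡y) = s , ≤-quotient m (index-bound m n s m²≤n sq≤n) , as≡y
      where
      sq≤n : suc s * suc s ≤ n
      sq≤n = ≤-trans (grows s) (<⇒≤ (subst (_< n) (sym as≡y) y<n))
    codes : All (λ y → ∃ λ s → s < n / m × a s ≡ y) xs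
    codes = All.map code members

module Enumeration {A : DecSet} (infinite : Infinite A) (L : ℕ) where
  enum : ℕ → ℕ
  enum zero = proj₁ (infinite L)
  enum (suc s) = proj₁ (infinite (suc (enum s)))

  enum-∈ : ∀ s → enum s ∈ₛ A
  enum-∈ zero = proj₂ (proj₂ (infinite L))
  enum-∈ (suc s) = proj₂ (proj₂ (infinite (suc (enum s))))

  enum-step : ∀ s → enum s < enum (suc s)
  enum-step s = proj₁ (proj₂ (infinite (suc (enum s))))

  enum-≥ : ∀ s → L ≤ enum s
  enum-≥ zero = proj₁ (proj₂ (infinite L))
  enum-≥ (suc s) = ≤-trans (enum-≥ s) (<⇒≤ (enum-step s))

  enum-increasing : ∀ {s t} → s < t → enum s < enum t
  enum-increasing {s} {suc t} (s≤s s≤t) with m≤n⇒m<n∨m≡n s≤t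
  ... | inj₁ s<t = <-trans (enum-increasing s<t) (enum-step t)
  ... | inj₂ refl = enum-step t

does-true : {P : Set} (d : Dec P) → does d ≡ true → P
does-true (yes p) _ = p

-- The range of a sequence with a s ≥ s is decidable: y is in it iff some
-- s ≤ y has a s ≡ y, a bounded search.
module BoundedRange (a : ℕ → ℕ) (a-≥ : ∀ s → s ≤ a s) where
  search : ∀ y → Dec (∃ λ (t : Fin (suc y)) → a (toℕ t) ≡ y)
  search y = any? (λ t → a (toℕ t) ≟ y)

  range : DecSet
  range y = does (search y)

  range-sound : ∀ y → y ∈ₛ range → Range a y
  range-sound y y∈ with t , at≡y ← does-true (search y) y∈ = toℕ t , at≡y

  range-complete : ∀ s → a s ∈ₛ range
  range-complete s = dec-true (search (a s)) (fromℕ< (s≤s (a-≥ s)) , cong a (toℕ-fromℕ< _))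

  range-infinite : Infinite range
  range-infinite n = a n , a-≥ n , range-complete n

module Construction (k : ℕ) (C : DecSet) (f : Fin (suc k) → ℕ → ℕ)
  (infinite : Infinite C) (injective : ∀ i → InjectiveOn (f i) C) where

  Large : ℕ → ℕ → Set
  Large T x = ∀ i → T ≤ f i x

  large? : ∀ T x → Dec (Large T x)
  large? T x = all? (λ i → T ≤? f i x)

  -- Pigeonhole: among the first (k+1)·T + 1 terms of a strictly increasing
  -- sequence in C some term is T-large; otherwise the pair (i, f i (c t))
  -- with f i (c t) < T would be an injective code into (k+1)·T values.
  large-term : (c : ℕ → ℕ) → (∀ {s t} → s < t → c s < c t) → (∀ s → c s ∈ₛ C) →
    ∀ T → ∃ λ s → Large T (c s)
  large-term c increasing c∈C T with any? (λ (t : Fin (suc (suc k * T))) → large? T (c (toℕ t)))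
  ... | yes (t , large) = toℕ t , large
  ... | no none = ⊥-elim collision
    where
    small : ∀ t → ∃ λ i → f i (c (toℕ t)) < T
    small t = map₂ ≰⇒> (¬∀⟶∃¬ _ _ (λ i → T ≤? f i (c (toℕ t))) (λ large → none (t , large)))
    code : Fin (suc (suc k * T)) → Fin (suc k * T)
    code t = combine (proj₁ (small t)) (fromℕ< (proj₂ (small t)))
    collision : ⊥
    collision with pigeonhole (n<1+n (suc k * T)) code
    ... | a , b , a<b , same-code with combine-injective (proj₁ (small a)) (fromℕ< (proj₂ (small a)))
                                                 (proj₁ (small b)) (fromℕ< (proj₂ (small b))) same-code
    ... | same-i , same-value =
      <-irrefl (injective i _ _ (c∈C (toℕ a)) (c∈C (toℕ b)) same-image) (increasing a<b)
      where
      i : Fin (suc k)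
      i = proj₁ (small a)
      same-image : f i (c (toℕ a)) ≡ f i (c (toℕ b))
      same-image = trans (fromℕ<-injective _ _ _ _ same-value)
                         (cong (λ j → f j (c (toℕ b))) (sym same-i))

  large-point : ∀ L T → ∃ λ x → L ≤ x × x ∈ₛ C × Large T x
  large-point L T = enum s , enum-≥ s , enum-∈ s , proj₂ found
    where
    open Enumeration infinite L
    found : ∃ λ s → Large T (enum s)
    found = large-term enum enum-increasing enum-∈ T
    s : ℕ
    s = proj₁ found

  h : ℕ → ℕ
  h j = proj₁ (large-point j (suc j * suc j))

  h-≥ : ∀ j → j ≤ h j
  h-≥ j = proj₁ (proj₂ (large-point j (suc j * suc j)))

  h-∈ : ∀ j → h j ∈ₛ C
  h-∈ j = proj₁ (proj₂ (proj₂ (large-point j (suc j * suc j))))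

  h-large : ∀ j → Large (suc j * suc j) (h j)
  h-large j = proj₂ (proj₂ (proj₂ (large-point j (suc j * suc j))))

  open BoundedRange h h-≥

  H : DecSet
  H = range

  H-infinite : Infinite H
  H-infinite = range-infinite

  H⊆C : H ⊆ₛ C
  H⊆C x x∈H with range-sound x x∈H
  ... | j , refl = h-∈ j

  -- f i (H) lies in the range of the quadratically growing sequence f i ∘ h.
  image-density : ∀ i → UpperDensityZero (InImage (f i) H)
  image-density i =
    density-zero-⊆ image⊆range (quadratic-range-density (λ s → f i (h s)) (λ s → h-large s i))
    where
    image⊆range : ∀ y → InImage (f i) H y → Range (λ s → f i (h s)) y
    image⊆range y (x , x∈H , fx≡y) with range-sound x x∈H
    ... | j , refl = j , fx≡y

lemma1p7 : (k : ℕ) (C : DecSet) (f : Fin (suc k) → ℕ → ℕ) →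
    Infinite C → (∀ i → InjectiveOn (f i) C) →
    ∃ λ (H : DecSet) → H ⊆ₛ C × Infinite H × (∀ i → UpperDensityZero (InImage (f i) H))
lemma1p7 k C f infinite injective = H , H⊆C , H-infinite , image-density
  where open Construction k C f infinite injective
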